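{- Let $p$ be a prime and $n\ge 1$ an integer. Then $$\mathrm{ord}_p(\overline{F}_n)=\sum_{b=1}^{\lfloor\log_p n\rfloor}\ \sum_{a=1}^{\lfloor n/p^b\rfloor}\left(\varphi(ap^b)\Big(2-\Big\lfloor\frac{n}{ap^b}\Big\rfloor\Big)-\sum_{j\mid ap}\mu(j)\Big\lfloor\frac{d}{j}\Big\rfloor\right),$$ where, for each pair $(a,b)$, $d=d(a,b)$ denotes the unique integer with $0\le d<ap^b$ and $d\equiv n \pmod{ap^b}$.
   Context: $\overline{F}_n=\Big(\prod_{1\le h\le k\le n,\ \gcd(h,k)=1}\frac{h}{k}\Big)^{ -1}$ is the reciprocal of the product of all nonzero Farey fractions of order $n$. For a nonzero rational $x$, $\mathrm{ord}_p(x)$ is the exponent of $p$ in $x$ (possibly negative). $\varphi$ is Euler's totient function, $\mu$ the M\"obius function, and the inner sum runs over the positive divisors $j$ of $ap$. -}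

module Defs where

open import Data.Bool.Base using (true; false; if_then_else_)
open import Data.Integer.Base as ℤ using (ℤ; +_; 0ℤ; -1ℤ)
open import Data.List.Base using (List; length; filter; applyUpTo; upTo)
open import Data.List.Relation.Unary.Any using (any?)
open import Data.Nat.Base
open import Data.Nat.Divisibility using (_∣?_)
open import Data.Nat.GCD using (gcd)
open import Data.Nat.Primality using (prime?)
open import Data.Nat.Properties using (_≟_; _≤?_)
open import Data.Rational.Base as ℚ using (ℚ; 1ℚ; ↥_; ↧ₙ_)
open import Data.Rational.Properties using (pos*pos⇒pos; normalize-pos; pos⇒nonZero)
open import Level using (0ℓ)
open import Relation.Nullary.Decidable using (does; _×-dec_)
open import Relation.Unary using (Pred; Decidable)

-- Indices run from 1, so the summand may divide by its index.

∑₁ : ℕ → ((i : ℕ) → .{{NonZero i}} → ℤ) → ℤ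
∑₁ zero    f = 0ℤ
∑₁ (suc n) f = ∑₁ n f ℤ.+ f (suc n)

∏₁ : ℕ → ((i : ℕ) → .{{NonZero i}} → ℚ) → ℚ
∏₁ zero    f = 1ℚ
∏₁ (suc n) f = ∏₁ n f ℚ.* f (suc n)

∑-divisors : ℕ → ((j : ℕ) → .{{NonZero j}} → ℤ) → ℤ
∑-divisors m f = ∑₁ m λ j → if does (j ∣? m) then f j else 0ℤ

infixr 5 ∑₁ ∏₁ ∑-divisors

syntax ∑₁ n (λ i → e) = ∑[1≤ i ≤ n ] e
syntax ∏₁ n (λ i → e) = ∏[1≤ i ≤ n ] e
syntax ∑-divisors m (λ j → e) = ∑[ j ∣ m ] e

-- The largest e with 1 ≤ e ≤ bound satisfying P, or 0 if there is none.

greatest : {P : Pred ℕ 0ℓ} → Decidable P → (bound : ℕ) → ℕ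
greatest P? zero    = 0
greatest P? (suc e) = if does (P? (suc e)) then suc e else greatest P? e

-- For b ≥ 2 and n ≥ 1, every e with b ^ e ≤ n satisfies e < n, so the bound n
-- loses nothing here or in `exponent`.

⌊log_⌋ : ℕ → ℕ → ℕ
⌊log b ⌋ n = greatest (λ e → b ^ e ≤? n) n

exponent : ℕ → ℕ → ℕ
exponent p n = greatest (λ e → p ^ e ∣? n) n

-- Only meaningful for x nonzero.

ord : ℕ → ℚ → ℤ
ord p x = + exponent p ℤ.∣ ↥ x ∣ ℤ.- + exponent p (↧ₙ x)

φ : ℕ → ℕ
φ m = length (filter (λ k → gcd k m ≟ 1) (applyUpTo suc m))

primeDivisors : ℕ → List ℕ
primeDivisors n = filter (λ q → prime? q ×-dec q ∣? n) (upTo (suc n))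

-- Only meaningful for n ≥ 1.

μ : ℕ → ℤ
μ n = if does (any? (λ q → q ^ 2 ∣? n) (primeDivisors n))
      then 0ℤ
      else -1ℤ ℤ.^ length (primeDivisors n)

fareyFactor : (h k : ℕ) → .{{NonZero k}} → ℚ
fareyFactor h k = if does (gcd h k ≟ 1) then + h ℚ./ k else 1ℚ

fareyProduct : ℕ → ℚ
fareyProduct n = ∏[1≤ k ≤ n ] ∏[1≤ h ≤ k ] fareyFactor h k

∏₁-positive : ∀ n (f : (i : ℕ) → .{{NonZero i}} → ℚ) →
              (∀ i .{{_ : NonZero i}} → ℚ.Positive (f i)) → ℚ.Positive (∏₁ n f)
∏₁-positive zero    f f>0 = _
∏₁-positive (suc n) f f>0 =
  pos*pos⇒pos (∏₁ n f) {{∏₁-positive n f f>0}} (f (suc n)) {{f>0 (suc n)}}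

fareyFactor-positive : ∀ h k .{{_ : NonZero h}} .{{_ : NonZero k}} →
                       ℚ.Positive (fareyFactor h k)
fareyFactor-positive h k with does (gcd h k ≟ 1)
... | true  = normalize-pos h k
... | false = _

fareyProduct-nonZero : ∀ n → ℚ.NonZero (fareyProduct n)
fareyProduct-nonZero n = pos⇒nonZero (fareyProduct n)
  {{∏₁-positive n _ λ k → ∏₁-positive k _ λ h → fareyFactor-positive h k}}

F̄ : ℕ → ℚ
F̄ n = (ℚ.1/ fareyProduct n) {{fareyProduct-nonZero n}}

{-# OPTIONS --safe #-}

-- By additivity of the exponent, ord_p(F̄_n) is the sum of v_p(k) − v_p(h) over the coprime
-- pairs h ≤ k ≤ n. Writing v_p(k) as the number of b ≥ 1 with p^b ∣ k, the level b
-- contributes, for each multiple m = a p^b ≤ n, φ(m) (from k = m) minus the number of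
-- k ∈ [m,n] prime to m (from h = m). With n = qm + d, that number is (q − 1)φ(m) plus the
-- number of k ≤ d prime to m. Being prime to a p^b is the same as being prime to ap, so
-- the last count is ∑_{j ∣ ap} μ(j)⌊d/j⌋ by Möbius inversion.

module Submission where

open import Defs
open import Data.Bool.Base using (true; false; if_then_else_)
open import Data.Integer.Base as ℤ using (ℤ; +_; 0ℤ; 1ℤ; -1ℤ)
import Data.Integer.GCD as ℤ
import Data.Integer.Properties as ℤ
open import Data.Integer.Tactic.RingSolver using (solve-∀)
open import Data.List.Base using ([]; _∷_; [_]; _++_; _∷ʳ_; length; filter; applyUpTo; upTo)
open import Data.List.Membership.Propositional using (_∈_; find; lose)
open import Data.List.Membership.Propositional.Properties using (∈-filter⁺; ∈-filter⁻; ∈-upTo⁺)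
open import Data.List.Membership.Propositional.Properties.WithK using (unique∧set⇒bag)
open import Data.List.Properties using (applyUpTo-∷ʳ; filter-++; length-++)
open import Data.List.Relation.Binary.BagAndSetEquality using (∼bag⇒↭)
open import Data.List.Relation.Binary.Permutation.Propositional.Properties using (↭-length)
open import Data.List.Relation.Unary.All as All using (_∷_)
open import Data.List.Relation.Unary.Any using (Any; here; there; any?)
open import Data.List.Relation.Unary.Unique.Propositional using (Unique; _∷_)
open import Data.List.Relation.Unary.Unique.Propositional.Properties using (filter⁺; upTo⁺)
open import Data.Nat.Base
open import Data.Nat.Coprimality as Coprimality
  using (Coprime; coprime-divisor; coprime⇒gcd≡1; gcd≡1⇒coprime)
open import Data.Nat.Divisibility
open import Data.Nat.DivMod using (m≡m%n+[m/n]*n; m%n<n; m*n/n≡m)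
open import Data.Nat.GCD using (gcd; gcd-comm; gcd[m,n]∣m; gcd[m,n]∣n; gcd-greatest)
open import Data.Nat.ListAction using (product)
open import Data.Nat.Primality
  using (Prime; prime?; ¬prime[1]; prime⇒nonZero; prime⇒nonTrivial; prime⇒irreducible; euclidsLemma)
open import Data.Nat.Primality.Factorisation using (factorise)
open import Data.Nat.Properties
open import Data.Nat.Solver using (module +-*-Solver)
open import Data.Product.Base using (∃; _×_; _,_; proj₁; proj₂)
open import Data.Rational.Base as ℚ using (ℚ; 1ℚ; ↥_; ↧_; ↧ₙ_)
open import Data.Rational.Properties as ℚ using (↥-*; ↧-*; ↥-/; ↧-/; pos⇒nonZero)
open import Data.Sum.Base using (inj₁; inj₂; [_,_]′)
open import Function.Base using (_∘_; it)
open import Function.Bundles using (mk⇔)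
open import Level using (0ℓ)
open import Relation.Binary.PropositionalEquality hiding ([_])
open import Relation.Nullary using (Dec; yes; no; ¬_; does; contradiction)
open import Relation.Nullary.Decidable using (dec-true; dec-false; does-⇔; _×-dec_)
open import Relation.Unary using (Pred; Decidable)

open ≡-Reasoning

-- Finite sums and indicators

private variable
  P Q : Set

∑-cong : ∀ n {f g : (i : ℕ) → .{{NonZero i}} → ℤ} →
         (∀ i .{{_ : NonZero i}} → i ≤ n → f i ≡ g i) → ∑₁ n f ≡ ∑₁ n g
∑-cong zero    f≡g = refl
∑-cong (suc n) f≡g =
  cong₂ ℤ._+_ (∑-cong n (λ i i≤n → f≡g i (m≤n⇒m≤1+n i≤n))) (f≡g (suc n) ≤-refl)

∑-zero : ∀ n {f : (i : ℕ) → .{{NonZero i}} → ℤ} →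
         (∀ i .{{_ : NonZero i}} → i ≤ n → f i ≡ 0ℤ) → ∑₁ n f ≡ 0ℤ
∑-zero zero    f≡0 = refl
∑-zero (suc n) f≡0 =
  cong₂ ℤ._+_ (∑-zero n (λ i i≤n → f≡0 i (m≤n⇒m≤1+n i≤n))) (f≡0 (suc n) ≤-refl)

∑-distrib-+ : ∀ n (f g : (i : ℕ) → .{{NonZero i}} → ℤ) →
              (∑[1≤ i ≤ n ] f i ℤ.+ g i) ≡ ∑₁ n f ℤ.+ ∑₁ n g
∑-distrib-+ zero    f g = refl
∑-distrib-+ (suc n) f g = begin
  (∑[1≤ i ≤ n ] f i ℤ.+ g i) ℤ.+ (f (suc n) ℤ.+ g (suc n))
    ≡⟨ cong (ℤ._+ (f (suc n) ℤ.+ g (suc n))) (∑-distrib-+ n f g) ⟩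
  (∑₁ n f ℤ.+ ∑₁ n g) ℤ.+ (f (suc n) ℤ.+ g (suc n))
    ≡⟨ interchange (∑₁ n f) (∑₁ n g) (f (suc n)) (g (suc n)) ⟩
  (∑₁ n f ℤ.+ f (suc n)) ℤ.+ (∑₁ n g ℤ.+ g (suc n)) ∎
  where
  interchange : ∀ a b c d → (a ℤ.+ b) ℤ.+ (c ℤ.+ d) ≡ (a ℤ.+ c) ℤ.+ (b ℤ.+ d)
  interchange = solve-∀

∑-*ˡ : ∀ n c (f : (i : ℕ) → .{{NonZero i}} → ℤ) →
       (∑[1≤ i ≤ n ] c ℤ.* f i) ≡ c ℤ.* ∑₁ n f
∑-*ˡ zero    c f = sym (ℤ.*-zeroʳ c)
∑-*ˡ (suc n) c f =
  trans (cong (ℤ._+ c ℤ.* f (suc n)) (∑-*ˡ n c f))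
        (sym (ℤ.*-distribˡ-+ c (∑₁ n f) (f (suc n))))

∑-neg : ∀ n (f : (i : ℕ) → .{{NonZero i}} → ℤ) →
        (∑[1≤ i ≤ n ] ℤ.- f i) ≡ ℤ.- ∑₁ n f
∑-neg zero    f = refl
∑-neg (suc n) f =
  trans (cong (ℤ._+ ℤ.- f (suc n)) (∑-neg n f))
        (sym (ℤ.neg-distrib-+ (∑₁ n f) (f (suc n))))

∑-distrib-minus : ∀ n (f g : (i : ℕ) → .{{NonZero i}} → ℤ) →
              (∑[1≤ i ≤ n ] f i ℤ.- g i) ≡ ∑₁ n f ℤ.- ∑₁ n g
∑-distrib-minus n f g =
  trans (∑-distrib-+ n f (λ i → ℤ.- g i)) (cong (λ x → ∑₁ n f ℤ.+ x) (∑-neg n g))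

∑-swap : ∀ m n (f : (i j : ℕ) → .{{NonZero i}} → .{{NonZero j}} → ℤ) →
         (∑[1≤ i ≤ m ] ∑[1≤ j ≤ n ] f i j) ≡ (∑[1≤ j ≤ n ] ∑[1≤ i ≤ m ] f i j)
∑-swap zero    n f = sym (∑-zero n (λ _ _ → refl))
∑-swap (suc m) n f =
  trans (cong (ℤ._+ (∑[1≤ j ≤ n ] f (suc m) j)) (∑-swap m n f))
        (sym (∑-distrib-+ n _ (λ j → f (suc m) j)))

∑-one : ∀ n → (∑[1≤ i ≤ n ] 1ℤ) ≡ + n
∑-one zero    = refl
∑-one (suc n) = trans (cong (ℤ._+ 1ℤ) (∑-one n)) (cong +_ (+-comm n 1))

-- The summand is a function on all of `ℕ`, so that shifting the index by `m` carries no `NonZero`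
-- argument along.
∑-split : ∀ m n (F : ℕ → ℤ) →
          (∑[1≤ i ≤ m + n ] F i) ≡ (∑[1≤ i ≤ m ] F i) ℤ.+ (∑[1≤ i ≤ n ] F (m + i))
∑-split m zero    F rewrite +-identityʳ m = sym (ℤ.+-identityʳ _)
∑-split m (suc n) F rewrite +-suc m n =
  trans (cong (ℤ._+ F (suc (m + n))) (∑-split m n F))
        (ℤ.+-assoc (∑[1≤ i ≤ m ] F i) (∑[1≤ i ≤ n ] F (m + i)) (F (suc (m + n))))

-- Lets sums whose natural upper bounds differ run over one common range, which is needed before two
-- summations can be exchanged.
∑-extend : ∀ {m n} → m ≤ n → (F : ℕ → ℤ) → (∀ i → m < i → F i ≡ 0ℤ) →
           (∑[1≤ i ≤ n ] F i) ≡ (∑[1≤ i ≤ m ] F i)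
∑-extend {m} {n} m≤n F F≡0 = begin
  (∑[1≤ i ≤ n ] F i)            ≡⟨ cong (λ k → ∑[1≤ i ≤ k ] F i) (m+[n∸m]≡n m≤n) ⟨
  (∑[1≤ i ≤ m + (n ∸ m) ] F i)  ≡⟨ ∑-split m (n ∸ m) F ⟩
  (∑[1≤ i ≤ m ] F i) ℤ.+ (∑[1≤ i ≤ n ∸ m ] F (m + i))
    ≡⟨ cong (λ x → (∑[1≤ i ≤ m ] F i) ℤ.+ x) (∑-zero (n ∸ m) (λ i _ → F≡0 (m + i) (m<m+n m (>-nonZero⁻¹ i)))) ⟩
  (∑[1≤ i ≤ m ] F i) ℤ.+ 0ℤ     ≡⟨ ℤ.+-identityʳ _ ⟩
  (∑[1≤ i ≤ m ] F i)            ∎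

-- Summing over the square [1,n]² as two triangles counts the diagonal twice.
∑-triangles : ∀ n (g : ℕ → ℕ → ℤ) →
  (∑[1≤ k ≤ n ] ∑[1≤ h ≤ k ] g h k) ℤ.+ (∑[1≤ h ≤ n ] ∑[1≤ k ≤ h ] g h k)
    ≡ (∑[1≤ h ≤ n ] ∑[1≤ k ≤ n ] g h k) ℤ.+ (∑[1≤ i ≤ n ] g i i)
∑-triangles zero    g = refl
∑-triangles (suc n) g = begin
  (A ℤ.+ (col ℤ.+ d)) ℤ.+ (B ℤ.+ (row ℤ.+ d))
    ≡⟨ shuffle₁ A B col row d ⟩
  (A ℤ.+ B) ℤ.+ (col ℤ.+ row ℤ.+ d ℤ.+ d)
    ≡⟨ cong (ℤ._+ (col ℤ.+ row ℤ.+ d ℤ.+ d)) (∑-triangles n g) ⟩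
  (S ℤ.+ D) ℤ.+ (col ℤ.+ row ℤ.+ d ℤ.+ d)
    ≡⟨ shuffle₂ S D col row d ⟩
  (S ℤ.+ col) ℤ.+ (row ℤ.+ d) ℤ.+ (D ℤ.+ d)
    ≡⟨ cong (λ s → s ℤ.+ (row ℤ.+ d) ℤ.+ (D ℤ.+ d)) (∑-distrib-+ n _ (λ h → g h (suc n))) ⟨
  (∑[1≤ h ≤ n ] ∑[1≤ k ≤ suc n ] g h k) ℤ.+ (row ℤ.+ d) ℤ.+ (D ℤ.+ d) ∎
  where
  A B S D col row d : ℤ
  A = ∑[1≤ k ≤ n ] ∑[1≤ h ≤ k ] g h k
  B = ∑[1≤ h ≤ n ] ∑[1≤ k ≤ h ] g h k
  S = ∑[1≤ h ≤ n ] ∑[1≤ k ≤ n ] g h k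
  D = ∑[1≤ i ≤ n ] g i i
  col = ∑[1≤ h ≤ n ] g h (suc n)
  row = ∑[1≤ k ≤ n ] g (suc n) k
  d = g (suc n) (suc n)
  shuffle₁ : ∀ A B c r d → (A ℤ.+ (c ℤ.+ d)) ℤ.+ (B ℤ.+ (r ℤ.+ d)) ≡ (A ℤ.+ B) ℤ.+ (c ℤ.+ r ℤ.+ d ℤ.+ d)
  shuffle₁ = solve-∀
  shuffle₂ : ∀ S D c r d → (S ℤ.+ D) ℤ.+ (c ℤ.+ r ℤ.+ d ℤ.+ d) ≡ (S ℤ.+ c) ℤ.+ (r ℤ.+ d) ℤ.+ (D ℤ.+ d)
  shuffle₂ = solve-∀

-- As an integer factor the condition obeys the linear rules for sums; `if-𝟙` translates to and from
-- the conditional inside `∑-divisors`.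
𝟙 : Dec P → ℤ
𝟙 p? = if does p? then 1ℤ else 0ℤ

𝟙-true : (p? : Dec P) → P → 𝟙 p? ≡ 1ℤ
𝟙-true p? p rewrite dec-true p? p = refl

𝟙-false : (p? : Dec P) → ¬ P → 𝟙 p? ≡ 0ℤ
𝟙-false p? ¬p rewrite dec-false p? ¬p = refl

𝟙-⇔ : (p? : Dec P) (q? : Dec Q) → (P → Q) → (Q → P) → 𝟙 p? ≡ 𝟙 q?
𝟙-⇔ p? q? p⇒q q⇒p = cong (if_then 1ℤ else 0ℤ) (does-⇔ (mk⇔ p⇒q q⇒p) p? q?)

if-𝟙 : (p? : Dec P) (x : ℤ) → (if does p? then x else 0ℤ) ≡ 𝟙 p? ℤ.* x
if-𝟙 p? x with does p?
... | true  = sym (ℤ.*-identityˡ x)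
... | false = refl

-- Cut the range into `n / M` blocks of length `M` and a remainder shorter than `M`: each block has
-- its only multiple of `M` at the end, and the remainder has none.
∑-multiples : ∀ n M .{{_ : NonZero M}} (F : ℕ → ℤ) →
              (∑[1≤ k ≤ n ] 𝟙 (M ∣? k) ℤ.* F k) ≡ (∑[1≤ a ≤ n / M ] F (a * M))
∑-multiples n M@(suc M-1) F = begin
  (∑[1≤ k ≤ n ] G k)
    ≡⟨ cong (λ k → ∑₁ k λ i → G i) (trans (m≡m%n+[m/n]*n n M) (+-comm (n % M) _)) ⟩
  (∑[1≤ k ≤ n / M * M + n % M ] G k)
    ≡⟨ ∑-split (n / M * M) (n % M) G ⟩
  (∑[1≤ k ≤ n / M * M ] G k) ℤ.+ (∑[1≤ i ≤ n % M ] G (n / M * M + i))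
    ≡⟨ cong₂ ℤ._+_ (blocks (n / M)) (gap (n / M) (m%n<n n M)) ⟩
  (∑[1≤ a ≤ n / M ] F (a * M)) ℤ.+ 0ℤ
    ≡⟨ ℤ.+-identityʳ _ ⟩
  (∑[1≤ a ≤ n / M ] F (a * M)) ∎
  where
  G : ℕ → ℤ
  G k = 𝟙 (M ∣? k) ℤ.* F k

  gap : ∀ q {d} → d < M → (∑[1≤ i ≤ d ] G (q * M + i)) ≡ 0ℤ
  gap q {d} d<M = ∑-zero d λ i i≤d →
    cong (ℤ._* F (q * M + i)) (𝟙-false (M ∣? (q * M + i)) λ M∣qM+i →
      <⇒≱ (≤-<-trans i≤d d<M) (∣⇒≤ (∣m+n∣m⇒∣n M∣qM+i (n∣m*n q))))

  blocks : ∀ q → (∑[1≤ k ≤ q * M ] G k) ≡ (∑[1≤ a ≤ q ] F (a * M))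
  blocks zero    = refl
  blocks (suc q) = begin
    (∑[1≤ k ≤ M + q * M ] G k)
      ≡⟨ cong (λ k → ∑₁ k λ i → G i) (+-comm M (q * M)) ⟩
    (∑[1≤ k ≤ q * M + M ] G k)
      ≡⟨ ∑-split (q * M) M G ⟩
    (∑[1≤ k ≤ q * M ] G k) ℤ.+ ((∑[1≤ i ≤ M-1 ] G (q * M + i)) ℤ.+ G (q * M + M))
      -- The first `M-1` places of the block form a gap, which leaves only its last entry.
      ≡⟨ cong₂ (λ x y → x ℤ.+ (y ℤ.+ G (q * M + M))) (blocks q) (gap q ≤-refl) ⟩
    (∑[1≤ a ≤ q ] F (a * M)) ℤ.+ (0ℤ ℤ.+ G (q * M + M))
      ≡⟨ cong (λ z → (∑[1≤ a ≤ q ] F (a * M)) ℤ.+ z) last ⟩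
    (∑[1≤ a ≤ q ] F (a * M)) ℤ.+ F (suc q * M) ∎
    where
    last : 0ℤ ℤ.+ G (q * M + M) ≡ F (suc q * M)
    last = begin
      0ℤ ℤ.+ G (q * M + M) ≡⟨ ℤ.+-identityˡ _ ⟩
      G (q * M + M)        ≡⟨ cong G (+-comm (q * M) M) ⟩
      G (suc q * M)        ≡⟨ cong (ℤ._* F (suc q * M)) (𝟙-true (M ∣? (suc q * M)) (n∣m*n (suc q))) ⟩
      1ℤ ℤ.* F (suc q * M) ≡⟨ ℤ.*-identityˡ _ ⟩
      F (suc q * M)        ∎

-- Exponents and orders

greatest-satisfies : {P : Pred ℕ 0ℓ} (P? : Decidable P) → P 0 → ∀ n → P (greatest P? n)
greatest-satisfies P? P0 zero = P0
greatest-satisfies P? P0 (suc n) with P? (suc n)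
... | yes Psn = Psn
... | no  _   = greatest-satisfies P? P0 n

greatest-maximal : {P : Pred ℕ 0ℓ} (P? : Decidable P) → ∀ n {e} → e ≤ n → P e → e ≤ greatest P? n
greatest-maximal P? zero    e≤0  Pe = e≤0
greatest-maximal P? (suc n) e≤sn Pe with P? (suc n)
... | yes _    = e≤sn
... | no ¬Psn = greatest-maximal P? n (≤-pred (≤∧≢⇒< e≤sn λ { refl → ¬Psn Pe })) Pe

-- Gives `e < p ^ e`, so the search bounds in `exponent` and `⌊log_⌋` exclude no valid exponent.
n<m^n : ∀ {m} → 1 < m → ∀ n → n < m ^ n
n<m^n     1<m zero    = s≤s z≤n
n<m^n {m} 1<m (suc n) = ≤-trans (s≤s (n<m^n 1<m n)) (^-monoʳ-< m 1<m (n<1+n n))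

^-monoʳ-∣ : ∀ m {a b} → a ≤ b → m ^ a ∣ m ^ b
^-monoʳ-∣ m {a} {b} a≤b =
  subst (m ^ a ∣_) (trans (sym (^-distribˡ-+-* m a (b ∸ a))) (cong (m ^_) (m+[n∸m]≡n a≤b)))
        (m∣m*n (m ^ (b ∸ a)))

module _ {p : ℕ} (p-prime : Prime p) where

  private instance
    p≢0 = prime⇒nonZero p-prime

  1<p : 1 < p
  1<p = nonTrivial⇒n>1 p {{prime⇒nonTrivial p-prime}}

  p^exponent∣ : ∀ k → p ^ exponent p k ∣ k
  p^exponent∣ k = greatest-satisfies (λ e → p ^ e ∣? k) (1∣ k) k

  exponent-maximal : ∀ k .{{_ : NonZero k}} {e} → p ^ e ∣ k → e ≤ exponent p k
  exponent-maximal k {e} p^e∣k =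
    greatest-maximal (λ e → p ^ e ∣? k) k (≤-trans (<⇒≤ (n<m^n 1<p e)) (∣⇒≤ p^e∣k)) p^e∣k

  exponent-≤-log : ∀ {k n} .{{_ : NonZero k}} → k ≤ n → exponent p k ≤ ⌊log p ⌋ n
  exponent-≤-log {k} {n} k≤n =
    greatest-maximal (λ e → p ^ e ≤? n) n (≤-trans (<⇒≤ (n<m^n 1<p (exponent p k))) p^v≤n) p^v≤n
    where
    p^v≤n : p ^ exponent p k ≤ n
    p^v≤n = ≤-trans (∣⇒≤ (p^exponent∣ k)) k≤n

  -- The powers of `p` dividing `k` are exactly those up to the exponent. Running `b` up to the
  -- logarithm of `n` makes the range independent of `k`, so that the sum over `b` can later be
  -- moved outermost.
  exponent-∑ : ∀ {k n} .{{_ : NonZero k}} → k ≤ n →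
               + exponent p k ≡ (∑[1≤ b ≤ ⌊log p ⌋ n ] 𝟙 (p ^ b ∣? k))
  exponent-∑ {k} {n} k≤n = begin
    + v                              ≡⟨ ∑-one v ⟨
    (∑[1≤ b ≤ v ] 1ℤ)                ≡⟨ ∑-cong v (λ b b≤v →
                                          𝟙-true (p ^ b ∣? k) (∣-trans (^-monoʳ-∣ p b≤v) (p^exponent∣ k))) ⟨
    (∑[1≤ b ≤ v ] 𝟙 (p ^ b ∣? k))    ≡⟨ ∑-extend (exponent-≤-log k≤n) (λ b → 𝟙 (p ^ b ∣? k))
                                          (λ b v<b → 𝟙-false (p ^ b ∣? k) (<⇒≱ v<b ∘ exponent-maximal k)) ⟨
    (∑[1≤ b ≤ ⌊log p ⌋ n ] 𝟙 (p ^ b ∣? k)) ∎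
    where v = exponent p k

  -- The maximal powers dividing `m` and `n` multiply to one dividing `m * n`. A higher power would
  -- force `p` to divide the product of the two cofactors, hence one of them by Euclid's lemma,
  -- against maximality.
  exponent-* : ∀ m n .{{_ : NonZero m}} .{{_ : NonZero n}} →
               exponent p (m * n) ≡ exponent p m + exponent p n
  exponent-* m n = ≤-antisym (≮⇒≥ too-large) (exponent-maximal (m * n) p^[v+w]∣mn)
    where
    instance
      mn≢0 = m*n≢0 m n
      p^v+w≢0 = m^n≢0 p (exponent p m + exponent p n)
    v = exponent p m
    w = exponent p n
    p^[v+w]∣mn : p ^ (v + w) ∣ m * n
    p^[v+w]∣mn = subst (_∣ m * n) (sym (^-distribˡ-+-* p v w)) (*-pres-∣ (p^exponent∣ m) (p^exponent∣ n))

    cofactor-indivisible : ∀ k .{{_ : NonZero k}} (d : p ^ exponent p k ∣ k) → ¬ p ∣ quotient d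
    cofactor-indivisible k d p∣q =
      <-irrefl refl (exponent-maximal k
        (subst (p ^ suc (exponent p k) ∣_) (sym (_∣_.equality d)) (*-monoˡ-∣ _ p∣q)))

    q = quotient (p^exponent∣ m)
    r = quotient (p^exponent∣ n)

    mn≡ : m * n ≡ p ^ (v + w) * (q * r)
    mn≡ = begin
      m * n                       ≡⟨ cong₂ _*_ (_∣_.equality (p^exponent∣ m)) (_∣_.equality (p^exponent∣ n)) ⟩
      (q * p ^ v) * (r * p ^ w)   ≡⟨ solve 4 (λ q a r b → (q :* a) :* (r :* b) := (a :* b) :* (q :* r)) refl
                                     q (p ^ v) r (p ^ w) ⟩
      (p ^ v * p ^ w) * (q * r)   ≡⟨ cong (_* (q * r)) (^-distribˡ-+-* p v w) ⟨
      p ^ (v + w) * (q * r)       ∎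
      where open +-*-Solver

    too-large : ¬ v + w < exponent p (m * n)
    too-large v+w<u = [ cofactor-indivisible m (p^exponent∣ m) , cofactor-indivisible n (p^exponent∣ n) ]′
      -- Cancelling `p ^ (v + w)` from `p ^ suc (v + w) ∣ m * n` leaves `p ∣ q * r`.
      (euclidsLemma q r p-prime (*-cancelˡ-∣ (p ^ (v + w))
        (subst₂ _∣_ (*-comm p _) mn≡ (∣-trans (^-monoʳ-∣ p v+w<u) (p^exponent∣ (m * n))))))

  -- c is the factor cancelled in reducing a / b to lowest terms.
  ord-fraction : ∀ x {a b} c .{{_ : NonZero a}} .{{_ : NonZero b}} →
                 ℤ.∣ ↥ x ∣ * c ≡ a → ↧ₙ x * c ≡ b →
                 ord p x ≡ + exponent p a ℤ.- + exponent p b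
  ord-fraction x@record{} {a} {b} c refl refl = begin
    + v₁ ℤ.- + v₂                        ≡⟨ cancel (+ v₁) (+ v₂) (+ v₃) ⟩
    + (v₁ + v₃) ℤ.- + (v₂ + v₃)          ≡⟨ cong₂ (λ s t → + s ℤ.- + t)
                                              (exponent-* ℤ.∣ ↥ x ∣ c) (exponent-* (↧ₙ x) c) ⟨
    + exponent p a ℤ.- + exponent p b    ∎
    where
    instance
      numerator≢0 = m*n≢0⇒m≢0 ℤ.∣ ↥ x ∣ {c}
      c≢0 = m*n≢0⇒n≢0 ℤ.∣ ↥ x ∣ {c}
    v₁ = exponent p ℤ.∣ ↥ x ∣
    v₂ = exponent p (↧ₙ x)
    v₃ = exponent p c
    cancel : ∀ a b c → a ℤ.- b ≡ (a ℤ.+ c) ℤ.- (b ℤ.+ c)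
    cancel = solve-∀

  ord-/ : ∀ h k .{{_ : NonZero h}} .{{_ : NonZero k}} →
          ord p (+ h ℚ./ k) ≡ + exponent p h ℤ.- + exponent p k
  ord-/ h k = ord-fraction (+ h ℚ./ k) (gcd h k)
    (trans (sym (ℤ.abs-* (↥ (+ h ℚ./ k)) (+ gcd h k))) (cong ℤ.∣_∣ (↥-/ (+ h) k)))
    (trans (sym (ℤ.abs-* (↧ (+ h ℚ./ k)) (+ gcd h k))) (cong ℤ.∣_∣ (↧-/ (+ h) k)))

  ord-* : ∀ x y .{{_ : ℚ.NonZero x}} .{{_ : ℚ.NonZero y}} →
          ord p (x ℚ.* y) ≡ ord p x ℤ.+ ord p y
  ord-* x@record{} y@record{} = begin
    ord p (x ℚ.* y)
      ≡⟨ ord-fraction (x ℚ.* y) ℤ.∣ nf ∣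
           (trans (sym (ℤ.abs-* (↥ (x ℚ.* y)) nf)) (trans (cong ℤ.∣_∣ (↥-* x y)) (ℤ.abs-* (↥ x) (↥ y))))
           (trans (sym (ℤ.abs-* (↧ (x ℚ.* y)) nf)) (trans (cong ℤ.∣_∣ (↧-* x y)) (ℤ.abs-* (↧ x) (↧ y)))) ⟩
    + exponent p (ℤ.∣ ↥ x ∣ * ℤ.∣ ↥ y ∣) ℤ.- + exponent p (↧ₙ x * ↧ₙ y)
      ≡⟨ cong₂ (λ s t → + s ℤ.- + t) (exponent-* ℤ.∣ ↥ x ∣ ℤ.∣ ↥ y ∣) (exponent-* (↧ₙ x) (↧ₙ y)) ⟩
    (+ a ℤ.+ + b) ℤ.- (+ c ℤ.+ + d)
      ≡⟨ regroup (+ a) (+ b) (+ c) (+ d) ⟩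
    (+ a ℤ.- + c) ℤ.+ (+ b ℤ.- + d) ∎
    where
    instance
      numerators≢0 = m*n≢0 ℤ.∣ ↥ x ∣ ℤ.∣ ↥ y ∣
    -- The factor removed when the product of the two fractions is brought to lowest terms.
    nf = ℤ.gcd (↥ x ℤ.* ↥ y) (↧ x ℤ.* ↧ y)
    a = exponent p ℤ.∣ ↥ x ∣
    b = exponent p ℤ.∣ ↥ y ∣
    c = exponent p (↧ₙ x)
    d = exponent p (↧ₙ y)
    regroup : ∀ a b c d → (a ℤ.+ b) ℤ.- (c ℤ.+ d) ≡ (a ℤ.- c) ℤ.+ (b ℤ.- d)
    regroup = solve-∀

  ord-1 : ord p 1ℚ ≡ 0ℤ
  ord-1 = ℤ.+-inverseʳ (+ exponent p 1)

  -- Additivity applied to `x ℚ.* ℚ.1/ x`, which equals 1 and has order 0.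
  ord-1/ : ∀ x .{{_ : ℚ.NonZero x}} → ord p (ℚ.1/ x) ≡ ℤ.- ord p x
  ord-1/ x = begin
    ord p (ℚ.1/ x)                              ≡⟨ isolate (ord p x) _ ⟩
    (ord p x ℤ.+ ord p (ℚ.1/ x)) ℤ.- ord p x    ≡⟨ cong (ℤ._- ord p x)
                                                     (ord-* x (ℚ.1/ x) {{it}} {{ℚ.nonZero⇒1/nonZero x}}) ⟨
    ord p (x ℚ.* ℚ.1/ x) ℤ.- ord p x            ≡⟨ cong (λ y → ord p y ℤ.- ord p x) (ℚ.*-inverseʳ x) ⟩
    ord p 1ℚ ℤ.- ord p x                        ≡⟨ cong (ℤ._- ord p x) ord-1 ⟩
    0ℤ ℤ.- ord p x                              ≡⟨ ℤ.+-identityˡ _ ⟩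
    ℤ.- ord p x                                 ∎
    where
    isolate : ∀ a b → b ≡ (a ℤ.+ b) ℤ.- a
    isolate = solve-∀

  -- Positivity passes to partial products and so supplies the nonzero factors that `ord-*`
  -- requires.
  ord-∏ : ∀ n (f : (i : ℕ) → .{{NonZero i}} → ℚ) → (∀ i .{{_ : NonZero i}} → ℚ.Positive (f i)) →
          ord p (∏₁ n f) ≡ (∑[1≤ i ≤ n ] ord p (f i))
  ord-∏ zero    f f>0 = ord-1
  ord-∏ (suc n) f f>0 =
    trans (ord-* (∏₁ n f) (f (suc n))
             {{pos⇒nonZero (∏₁ n f) {{∏₁-positive n f f>0}}}} {{pos⇒nonZero (f (suc n)) {{f>0 (suc n)}}}})
          (cong (ℤ._+ ord p (f (suc n))) (ord-∏ n f f>0))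

  ord-fareyFactor : ∀ h k .{{_ : NonZero h}} .{{_ : NonZero k}} →
    ord p (fareyFactor h k) ≡ 𝟙 (gcd h k ≟ 1) ℤ.* (+ exponent p h ℤ.- + exponent p k)
  ord-fareyFactor h k with does (gcd h k ≟ 1)
  ... | true  = trans (ord-/ h k) (sym (ℤ.*-identityˡ _))
  ... | false = ord-1

  ord-F̄ : ∀ n → ord p (F̄ n) ≡
    (∑[1≤ k ≤ n ] ∑[1≤ h ≤ k ] 𝟙 (gcd h k ≟ 1) ℤ.* (+ exponent p k ℤ.- + exponent p h))
  ord-F̄ n = begin
    ord p (F̄ n)
      ≡⟨ ord-1/ (fareyProduct n) {{fareyProduct-nonZero n}} ⟩
    ℤ.- ord p (fareyProduct n)
      ≡⟨ cong ℤ.-_ (ord-∏ n _ λ k → ∏₁-positive k _ λ h → fareyFactor-positive h k) ⟩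
    ℤ.- (∑[1≤ k ≤ n ] ord p (∏[1≤ h ≤ k ] fareyFactor h k))
      ≡⟨ ∑-neg n (λ k → ord p (∏[1≤ h ≤ k ] fareyFactor h k)) ⟨
    (∑[1≤ k ≤ n ] ℤ.- ord p (∏[1≤ h ≤ k ] fareyFactor h k))
      ≡⟨ ∑-cong n (λ k _ → cong ℤ.-_ (ord-∏ k _ λ h → fareyFactor-positive h k)) ⟩
    (∑[1≤ k ≤ n ] ℤ.- (∑[1≤ h ≤ k ] ord p (fareyFactor h k)))
      ≡⟨ ∑-cong n (λ k _ → sym (∑-neg k (λ h → ord p (fareyFactor h k)))) ⟩
    (∑[1≤ k ≤ n ] ∑[1≤ h ≤ k ] ℤ.- ord p (fareyFactor h k))
      ≡⟨ ∑-cong n (λ k _ → ∑-cong k λ h _ →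
           trans (cong ℤ.-_ (ord-fareyFactor h k))
                 -- The sign from the reciprocal is absorbed by exchanging `h` and `k` in the
                 -- difference.
                 (flip (𝟙 (gcd h k ≟ 1)) (+ exponent p h) (+ exponent p k))) ⟩
    (∑[1≤ k ≤ n ] ∑[1≤ h ≤ k ] 𝟙 (gcd h k ≟ 1) ℤ.* (+ exponent p k ℤ.- + exponent p h)) ∎
    where
    flip : ∀ c x y → ℤ.- (c ℤ.* (x ℤ.- y)) ≡ c ℤ.* (y ℤ.- x)
    flip = solve-∀

-- The Möbius function

prime∤⇒coprime : ∀ {p n} → Prime p → ¬ p ∣ n → Coprime p n
prime∤⇒coprime p-prime p∤n (d∣p , d∣n) with prime⇒irreducible p-prime d∣p
... | inj₁ d≡1  = d≡1
... | inj₂ refl = contradiction d∣n p∤n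

prime∣prime⇒≡ : ∀ {p q} → Prime p → Prime q → p ∣ q → p ≡ q
prime∣prime⇒≡ p-prime q-prime p∣q with prime⇒irreducible q-prime p∣q
... | inj₁ refl = contradiction p-prime ¬prime[1]
... | inj₂ p≡q  = p≡q

∃-prime-divisor : ∀ n .{{_ : NonZero n}} → n ≢ 1 → ∃ λ q → Prime q × q ∣ n
∃-prime-divisor n n≢1 with factorise n
... | record { factors = [] ; isFactorisation = n≡1 } = contradiction n≡1 n≢1
... | record { factors = q ∷ qs ; isFactorisation = n≡qΠ ; factorsPrime = q-prime ∷ _ } =
  q , q-prime , subst (q ∣_) (sym n≡qΠ) (m∣m*n (product qs))

∈-primeDivisors⁺ : ∀ {q n} .{{_ : NonZero n}} → Prime q → q ∣ n → q ∈ primeDivisors n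
∈-primeDivisors⁺ {q} {n} q-prime q∣n =
  ∈-filter⁺ (λ q → prime? q ×-dec q ∣? n) (∈-upTo⁺ (s≤s (∣⇒≤ q∣n))) (q-prime , q∣n)

∈-primeDivisors⁻ : ∀ n {q} → q ∈ primeDivisors n → Prime q × q ∣ n
∈-primeDivisors⁻ n = proj₂ ∘ ∈-filter⁻ (λ q → prime? q ×-dec q ∣? n) {xs = upTo (suc n)}

primeDivisors-unique : ∀ n → Unique (primeDivisors n)
primeDivisors-unique n = filter⁺ (λ q → prime? q ×-dec q ∣? n) (upTo⁺ (suc n))

HasSquare : ℕ → Set
HasSquare n = Any (λ q → q ^ 2 ∣ n) (primeDivisors n)

-- The very test on which `μ n` branches.
hasSquare? : ∀ n → Dec (HasSquare n)
hasSquare? n = any? (λ q → q ^ 2 ∣? n) (primeDivisors n)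

HasSquare⁺ : ∀ {q n} .{{_ : NonZero n}} → Prime q → q ^ 2 ∣ n → HasSquare n
HasSquare⁺ {q} q-prime q²∣n = lose (∈-primeDivisors⁺ q-prime (∣-trans (m∣m*n (q ^ 1)) q²∣n)) q²∣n

HasSquare⁻ : ∀ n → HasSquare n → ∃ λ q → Prime q × q ^ 2 ∣ n
HasSquare⁻ n sq with find sq
... | q , q∈ , q²∣n = q , proj₁ (∈-primeDivisors⁻ n q∈) , q²∣n

module _ {q : ℕ} (q-prime : Prime q) where

  private instance
    q≢0 = prime⇒nonZero q-prime

  -- The lists `primeDivisors (j * q)` and `q ∷ primeDivisors j` have no repetitions and the same
  -- members, so they are permutations of each other.
  length-primeDivisors-* : ∀ j .{{_ : NonZero j}} → ¬ q ∣ j →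
    length (primeDivisors (j * q)) ≡ suc (length (primeDivisors j))
  length-primeDivisors-* j q∤j = ↭-length (∼bag⇒↭ (unique∧set⇒bag
    (primeDivisors-unique (j * q))
    (All.tabulate (λ { q∈ refl → q∤j (proj₂ (∈-primeDivisors⁻ j q∈)) }) ∷ primeDivisors-unique j)
    (mk⇔ to from)))
    where
    instance jq≢0 = m*n≢0 j q

    to : ∀ {r} → r ∈ primeDivisors (j * q) → r ∈ q ∷ primeDivisors j
    to r∈ with ∈-primeDivisors⁻ (j * q) r∈
    ... | r-prime , r∣jq with euclidsLemma j q r-prime r∣jq
    ...   | inj₁ r∣j = there (∈-primeDivisors⁺ r-prime r∣j)
    ...   | inj₂ r∣q = here (prime∣prime⇒≡ r-prime q-prime r∣q)

    from : ∀ {r} → r ∈ q ∷ primeDivisors j → r ∈ primeDivisors (j * q)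
    from (here refl) = ∈-primeDivisors⁺ q-prime (n∣m*n j)
    from (there r∈) with ∈-primeDivisors⁻ j r∈
    ... | r-prime , r∣j = ∈-primeDivisors⁺ r-prime (∣m⇒∣m*n q r∣j)

  -- Let `r ^ 2` divide `j * q`. If `r` is `q`, cancelling one factor gives `q ∣ j`, which is
  -- excluded; otherwise `r ^ 2` is coprime to `q` and divides `j`.
  HasSquare-*-∤ : ∀ j .{{_ : NonZero j}} → ¬ q ∣ j → HasSquare (j * q) → HasSquare j
  HasSquare-*-∤ j q∤j sq with HasSquare⁻ (j * q) sq
  ... | r , r-prime , r²∣jq with r ≟ q
  ...   | yes refl = contradiction (*-cancelʳ-∣ q (subst (_∣ j * q) (cong (q *_) (*-identityʳ q)) r²∣jq)) q∤j
  ...   | no r≢q = HasSquare⁺ r-prime (coprime-divisor r²⊥q (subst (r ^ 2 ∣_) (*-comm j q) r²∣jq))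
    where
    r²⊥q : Coprime (r ^ 2) q
    r²⊥q = Coprimality.sym (prime∤⇒coprime q-prime λ q∣r² →
      [ r≢q ∘ sym ∘ prime∣prime⇒≡ q-prime r-prime
      , r≢q ∘ sym ∘ prime∣prime⇒≡ q-prime r-prime ∘ subst (q ∣_) (*-identityʳ r)
      ]′ (euclidsLemma r (r ^ 1) q-prime q∣r²))

  -- Here `q ^ 2` divides `j * q`.
  μ-*-∣ : ∀ j .{{_ : NonZero j}} → q ∣ j → μ (j * q) ≡ 0ℤ
  μ-*-∣ j q∣j = cong (if_then 0ℤ else -1ℤ ℤ.^ length (primeDivisors (j * q))) (dec-true (hasSquare? (j * q))
    (HasSquare⁺ {{m*n≢0 j q}} q-prime
      (subst (_∣ j * q) (cong (q *_) (sym (*-identityʳ q))) (*-monoˡ-∣ q q∣j))))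

  -- The new prime creates no square and lengthens the list of prime divisors by one, which is one
  -- more factor -1.
  μ-*-∤ : ∀ j .{{_ : NonZero j}} → ¬ q ∣ j → μ (j * q) ≡ ℤ.- μ j
  μ-*-∤ j q∤j = begin
    μ (j * q)
      ≡⟨ cong₂ (λ b l → if b then 0ℤ else -1ℤ ℤ.^ l)
           (does-⇔ (mk⇔ (HasSquare-*-∤ j q∤j) up) (hasSquare? (j * q)) (hasSquare? j))
           (length-primeDivisors-* j q∤j) ⟩
    (if does (hasSquare? j) then 0ℤ else -1ℤ ℤ.* s)
      ≡⟨ neg-if (does (hasSquare? j)) ⟩
    ℤ.- μ j ∎
    where
    s = -1ℤ ℤ.^ length (primeDivisors j)
    up : HasSquare j → HasSquare (j * q)
    up sq with HasSquare⁻ j sq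
    ... | r , r-prime , r²∣j = HasSquare⁺ {{m*n≢0 j q}} r-prime (∣m⇒∣m*n q r²∣j)
    neg-if : ∀ b → (if b then 0ℤ else -1ℤ ℤ.* s) ≡ ℤ.- (if b then 0ℤ else s)
    neg-if true  = refl
    neg-if false = ℤ.-1*i≡-i s

  -- The divisors of g = g′q prime to q are exactly those of g′ prime to q, and the
  -- divisors jq of g cancel them.
  ∑-μ-cancel : ∀ g′ .{{_ : NonZero g′}} → (∑[ j ∣ g′ * q ] μ j) ≡ 0ℤ
  ∑-μ-cancel g′ = begin
    (∑[ j ∣ g ] μ j)
      ≡⟨ ∑-cong g (λ j _ → trans (if-𝟙 (j ∣? g) (μ j)) (split j)) ⟩
    (∑[1≤ j ≤ g ] U j ℤ.+ 𝟙 (q ∣? j) ℤ.* W j)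
      ≡⟨ ∑-distrib-+ g (λ j → U j) (λ j → 𝟙 (q ∣? j) ℤ.* W j) ⟩
    (∑[1≤ j ≤ g ] U j) ℤ.+ (∑[1≤ j ≤ g ] 𝟙 (q ∣? j) ℤ.* W j)
      -- A divisor of `g′ * q` prime to `q` divides `g′`, so the first sum stops at `g′`; the
      -- multiples of `q` are reindexed as `i * q`.
      ≡⟨ cong₂ ℤ._+_ (∑-extend (m≤m*n g′ q) U U≡0) (∑-multiples g q W) ⟩
    (∑[1≤ j ≤ g′ ] U j) ℤ.+ (∑[1≤ i ≤ g / q ] W (i * q))
      ≡⟨ cong (λ m → (∑[1≤ j ≤ g′ ] U j) ℤ.+ (∑₁ m λ i → W (i * q))) (m*n/n≡m g′ q) ⟩
    (∑[1≤ j ≤ g′ ] U j) ℤ.+ (∑[1≤ i ≤ g′ ] W (i * q))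
      ≡⟨ cong (λ z → (∑[1≤ j ≤ g′ ] U j) ℤ.+ z) (trans (∑-cong g′ (λ i _ → W≡-U i)) (∑-neg g′ (λ i → U i))) ⟩
    (∑[1≤ j ≤ g′ ] U j) ℤ.- (∑[1≤ j ≤ g′ ] U j)
      ≡⟨ ℤ.+-inverseʳ (∑[1≤ j ≤ g′ ] U j) ⟩
    0ℤ ∎
    where
    g = g′ * q
    -- `W` is the term at any divisor of `g`; `U` keeps it only when `q` does not divide `j`.
    U W : ℕ → ℤ
    U j = (1ℤ ℤ.- 𝟙 (q ∣? j)) ℤ.* (𝟙 (j ∣? g) ℤ.* μ j)
    W j = 𝟙 (j ∣? g) ℤ.* μ j

    split : ∀ j → W j ≡ U j ℤ.+ 𝟙 (q ∣? j) ℤ.* W j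
    split j = lem (𝟙 (q ∣? j)) (W j)
      where
      lem : ∀ c w → w ≡ (1ℤ ℤ.- c) ℤ.* w ℤ.+ c ℤ.* w
      lem = solve-∀

    U≡0 : ∀ j → g′ < j → U j ≡ 0ℤ
    U≡0 j g′<j with q ∣? j
    ... | yes _  = refl
    ... | no q∤j = trans (ℤ.*-identityˡ (W j)) (cong (ℤ._* μ j) (𝟙-false (j ∣? g) λ j∣g →
      >⇒∤ g′<j (coprime-divisor (Coprimality.sym (prime∤⇒coprime q-prime q∤j)) (subst (j ∣_) (*-comm g′ q) j∣g))))

    -- If `q ∣ i`, both sides vanish. Otherwise `i * q` divides `g` exactly when `i` does, and `μ`
    -- changes sign.
    W≡-U : ∀ i .{{_ : NonZero i}} → W (i * q) ≡ ℤ.- U i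
    W≡-U i with q ∣? i
    ... | yes q∣i = trans (cong (λ z → 𝟙 (i * q ∣? g) ℤ.* z) (μ-*-∣ i q∣i)) (ℤ.*-zeroʳ (𝟙 (i * q ∣? g)))
    ... | no q∤i  = begin
      𝟙 (i * q ∣? g) ℤ.* μ (i * q)
        ≡⟨ cong₂ ℤ._*_ (𝟙-⇔ (i * q ∣? g) (i ∣? g) (∣-trans (m∣m*n q)) i∣g⇒iq∣g) (μ-*-∤ i q∤i) ⟩
      𝟙 (i ∣? g) ℤ.* ℤ.- μ i
        ≡⟨ lem (𝟙 (i ∣? g)) (μ i) ⟩
      ℤ.- (1ℤ ℤ.* W i) ∎
      where
      lem : ∀ c x → c ℤ.* ℤ.- x ≡ ℤ.- (1ℤ ℤ.* (c ℤ.* x))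
      lem = solve-∀
      i∣g⇒iq∣g : i ∣ g → i * q ∣ g
      i∣g⇒iq∣g i∣g = *-monoˡ-∣ q
        (coprime-divisor (Coprimality.sym (prime∤⇒coprime q-prime q∤i)) (subst (i ∣_) (*-comm g′ q) i∣g))

∑-μ : ∀ g .{{_ : NonZero g}} → (∑[ j ∣ g ] μ j) ≡ 𝟙 (g ≟ 1)
∑-μ g with g ≟ 1
... | yes refl = refl
... | no g≢1 with ∃-prime-divisor g g≢1
...   | q , q-prime , divides-refl g′ =
  trans (∑-μ-cancel q-prime g′ {{m*n≢0⇒m≢0 g′ {q}}}) (sym (𝟙-false (g′ * q ≟ 1) g≢1))

-- Counting coprime integers

-- The modulus `m` and the range `n` are independent, with Euler's `φ m` as the case `n = m`.
cop : ℕ → ℕ → ℤ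
cop m n = ∑[1≤ k ≤ n ] 𝟙 (gcd k m ≟ 1)

-- Replace each coprimality indicator by the sum of `μ` over the common divisors of `k` and `N`,
-- exchange the sums, and count the multiples of `j` up to `d`.
cop-μ : ∀ N d .{{_ : NonZero N}} → cop N d ≡ (∑[ j ∣ N ] μ j ℤ.* + (d / j))
cop-μ N d = begin
  (∑[1≤ k ≤ d ] 𝟙 (gcd k N ≟ 1))
    ≡⟨ ∑-cong d (λ k _ → indicator k) ⟩
  (∑[1≤ k ≤ d ] ∑[1≤ j ≤ N ] 𝟙 (j ∣? N) ℤ.* (𝟙 (j ∣? k) ℤ.* μ j))
    ≡⟨ ∑-swap d N (λ k j → 𝟙 (j ∣? N) ℤ.* (𝟙 (j ∣? k) ℤ.* μ j)) ⟩
  (∑[1≤ j ≤ N ] ∑[1≤ k ≤ d ] 𝟙 (j ∣? N) ℤ.* (𝟙 (j ∣? k) ℤ.* μ j))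
    ≡⟨ ∑-cong N (λ j _ → inner j) ⟩
  (∑[ j ∣ N ] μ j ℤ.* + (d / j)) ∎
  where
  indicator : ∀ k .{{_ : NonZero k}} →
    𝟙 (gcd k N ≟ 1) ≡ (∑[1≤ j ≤ N ] 𝟙 (j ∣? N) ℤ.* (𝟙 (j ∣? k) ℤ.* μ j))
  indicator k = begin
    𝟙 (g ≟ 1)           ≡⟨ ∑-μ g ⟨
    (∑[ j ∣ g ] μ j)    ≡⟨ ∑-cong g (λ j _ → trans (if-𝟙 (j ∣? g) (μ j)) (both j)) ⟩
    -- Terms beyond the gcd are zero, so the range becomes `N` for every `k`, as the exchange of
    -- sums demands.
    (∑[1≤ j ≤ g ] T j)  ≡⟨ ∑-extend (∣⇒≤ (gcd[m,n]∣n k N)) T T≡0 ⟨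
    (∑[1≤ j ≤ N ] T j)  ∎
    where
    g = gcd k N
    instance
      g≢0 : NonZero g
      g≢0 = ≢-nonZero λ g≡0 → ≢-nonZero⁻¹ N (0∣⇒≡0 (subst (_∣ N) g≡0 (gcd[m,n]∣n k N)))
    T : ℕ → ℤ
    T j = 𝟙 (j ∣? N) ℤ.* (𝟙 (j ∣? k) ℤ.* μ j)
    both : ∀ j → 𝟙 (j ∣? g) ℤ.* μ j ≡ T j
    both j with j ∣? N | j ∣? k
    ... | yes j∣N | yes j∣k rewrite 𝟙-true (j ∣? g) (gcd-greatest j∣k j∣N) = sym (ℤ.*-identityˡ _)
    ... | yes _   | no j∤k  rewrite 𝟙-false (j ∣? g) (λ j∣g → j∤k (∣-trans j∣g (gcd[m,n]∣m k N))) = refl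
    ... | no j∤N  | _       rewrite 𝟙-false (j ∣? g) (λ j∣g → j∤N (∣-trans j∣g (gcd[m,n]∣n k N))) = refl
    T≡0 : ∀ j → g < j → T j ≡ 0ℤ
    T≡0 j g<j = trans (sym (both j)) (cong (ℤ._* μ j) (𝟙-false (j ∣? g) (>⇒∤ g<j)))

  inner : ∀ j .{{_ : NonZero j}} →
    (∑[1≤ k ≤ d ] 𝟙 (j ∣? N) ℤ.* (𝟙 (j ∣? k) ℤ.* μ j))
      ≡ (if does (j ∣? N) then μ j ℤ.* + (d / j) else 0ℤ)
  inner j = begin
    (∑[1≤ k ≤ d ] 𝟙 (j ∣? N) ℤ.* (𝟙 (j ∣? k) ℤ.* μ j))
      ≡⟨ ∑-cong d (λ k _ → lem (𝟙 (j ∣? N)) (𝟙 (j ∣? k)) (μ j)) ⟩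
    (∑[1≤ k ≤ d ] (𝟙 (j ∣? N) ℤ.* μ j) ℤ.* (𝟙 (j ∣? k) ℤ.* 1ℤ))
      ≡⟨ ∑-*ˡ d (𝟙 (j ∣? N) ℤ.* μ j) (λ k → 𝟙 (j ∣? k) ℤ.* 1ℤ) ⟩
    𝟙 (j ∣? N) ℤ.* μ j ℤ.* (∑[1≤ k ≤ d ] 𝟙 (j ∣? k) ℤ.* 1ℤ)
      ≡⟨ cong (λ z → 𝟙 (j ∣? N) ℤ.* μ j ℤ.* z) (trans (∑-multiples d j (λ _ → 1ℤ)) (∑-one (d / j))) ⟩
    𝟙 (j ∣? N) ℤ.* μ j ℤ.* + (d / j)
      ≡⟨ ℤ.*-assoc (𝟙 (j ∣? N)) (μ j) (+ (d / j)) ⟩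
    𝟙 (j ∣? N) ℤ.* (μ j ℤ.* + (d / j))
      ≡⟨ if-𝟙 (j ∣? N) (μ j ℤ.* + (d / j)) ⟨
    (if does (j ∣? N) then μ j ℤ.* + (d / j) else 0ℤ) ∎
    where
    lem : ∀ a b c → a ℤ.* (b ℤ.* c) ≡ (a ℤ.* c) ℤ.* (b ℤ.* 1ℤ)
    lem = solve-∀

length-filter-gcd : ∀ m n → + length (filter (λ k → gcd k m ≟ 1) (applyUpTo suc n)) ≡ cop m n
length-filter-gcd m zero    = refl
length-filter-gcd m (suc n) = begin
  + length (filter P? (applyUpTo suc (suc n)))
    -- Sums grow at their upper end, so the list is split at its last entry rather than its first.
    ≡⟨ cong (λ ks → + length (filter P? ks)) (applyUpTo-∷ʳ suc n) ⟨
  + length (filter P? (applyUpTo suc n ∷ʳ suc n))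
    ≡⟨ cong (+_ ∘ length) (filter-++ P? (applyUpTo suc n) [ suc n ]) ⟩
  + length (filter P? (applyUpTo suc n) ++ filter P? [ suc n ])
    ≡⟨ cong +_ (length-++ (filter P? (applyUpTo suc n))) ⟩
  + length (filter P? (applyUpTo suc n)) ℤ.+ + length (filter P? [ suc n ])
    ≡⟨ cong₂ ℤ._+_ (length-filter-gcd m n) singleton ⟩
  cop m n ℤ.+ 𝟙 (P? (suc n)) ∎
  where
  P? : ∀ k → Dec (gcd k m ≡ 1)
  P? k = gcd k m ≟ 1
  singleton : + length (filter P? [ suc n ]) ≡ 𝟙 (P? (suc n))
  singleton with does (P? (suc n))
  ... | true  = refl
  ... | false = refl

φ≡cop : ∀ m → + φ m ≡ cop m m
φ≡cop m = length-filter-gcd m m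

gcd-shift : ∀ k m q → gcd (q * m + k) m ≡ gcd k m
gcd-shift k m q = ∣-antisym
  (gcd-greatest (∣m+n∣m⇒∣n (gcd[m,n]∣m (q * m + k) m) (∣n⇒∣m*n q (gcd[m,n]∣n (q * m + k) m)))
                (gcd[m,n]∣n (q * m + k) m))
  (gcd-greatest (∣m∣n⇒∣m+n (∣n⇒∣m*n q (gcd[m,n]∣n k m)) (gcd[m,n]∣m k m)) (gcd[m,n]∣n k m))

-- Coprimality to `m` depends only on the residue modulo `m`, so each of the `q` full blocks
-- contributes `cop m m`.
cop-periodic : ∀ m q d → cop m (q * m + d) ≡ + q ℤ.* cop m m ℤ.+ cop m d
cop-periodic m q d = begin
  cop m (q * m + d)
    ≡⟨ shift q d ⟩
  cop m (q * m) ℤ.+ cop m d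
    ≡⟨ cong (ℤ._+ cop m d) (blocks q) ⟩
  + q ℤ.* cop m m ℤ.+ cop m d ∎
  where
  shift : ∀ q d → cop m (q * m + d) ≡ cop m (q * m) ℤ.+ cop m d
  shift q d = trans (∑-split (q * m) d (λ k → 𝟙 (gcd k m ≟ 1)))
    (cong (λ z → cop m (q * m) ℤ.+ z) (∑-cong d λ k _ → cong (λ g → 𝟙 (g ≟ 1)) (gcd-shift k m q)))
  blocks : ∀ q → cop m (q * m) ≡ + q ℤ.* cop m m
  blocks zero    = sym (ℤ.*-zeroˡ (cop m m))
  blocks (suc q) = begin
    cop m (m + q * m)             ≡⟨ cong (cop m) (+-comm m (q * m)) ⟩
    cop m (q * m + m)             ≡⟨ shift q m ⟩
    cop m (q * m) ℤ.+ cop m m     ≡⟨ cong (ℤ._+ cop m m) (blocks q) ⟩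
    + q ℤ.* cop m m ℤ.+ cop m m   ≡⟨ ℤ.+-comm (+ q ℤ.* cop m m) (cop m m) ⟩
    cop m m ℤ.+ + q ℤ.* cop m m   ≡⟨ ℤ.suc-* (+ q) (cop m m) ⟨
    + suc q ℤ.* cop m m           ∎

cop-divMod : ∀ m n .{{_ : NonZero m}} → cop m n ≡ + (n / m) ℤ.* + φ m ℤ.+ cop m (n % m)
cop-divMod m n = begin
  cop m n                                     ≡⟨ cong (cop m)
                                                   (trans (m≡m%n+[m/n]*n n m) (+-comm (n % m) (n / m * m))) ⟩
  cop m (n / m * m + n % m)                   ≡⟨ cop-periodic m (n / m) (n % m) ⟩
  + (n / m) ℤ.* cop m m ℤ.+ cop m (n % m)     ≡⟨ cong (λ z → + (n / m) ℤ.* z ℤ.+ cop m (n % m)) (φ≡cop m) ⟨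
  + (n / m) ℤ.* + φ m ℤ.+ cop m (n % m)       ∎

-- A common divisor of `k` and `a * c` inherits coprimality to `a` from `k`, so it divides `c` and
-- is 1.
coprime-*ʳ : ∀ {k a c} → Coprime k a → Coprime k c → Coprime k (a * c)
coprime-*ʳ {k} {a} k⊥a k⊥c {d} (d∣k , d∣ac) = k⊥c (d∣k , coprime-divisor d⊥a d∣ac)
  where
  d⊥a : Coprime d a
  d⊥a (e∣d , e∣a) = k⊥a (∣-trans e∣d d∣k , e∣a)

coprime-^ʳ : ∀ {k c} b → Coprime k c → Coprime k (c ^ b)
coprime-^ʳ zero    k⊥c = ∣1⇒≡1 ∘ proj₂
coprime-^ʳ (suc b) k⊥c = coprime-*ʳ k⊥c (coprime-^ʳ b k⊥c)

-- For positive `b`, the numbers `a * c ^ b` and `a * c` have the same prime divisors. This is why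
-- the Möbius sum of the theorem runs over the divisors of `a * p` only.
cop-radical : ∀ a c b d .{{_ : NonZero b}} → cop (a * c ^ b) d ≡ cop (a * c) d
cop-radical a c b@(suc b-1) d = ∑-cong d λ k _ →
  𝟙-⇔ (gcd k (a * c ^ b) ≟ 1) (gcd k (a * c) ≟ 1)
    (coprime⇒gcd≡1 ∘ to k ∘ gcd≡1⇒coprime) (coprime⇒gcd≡1 ∘ from k ∘ gcd≡1⇒coprime)
  where
  to : ∀ k → Coprime k (a * c ^ b) → Coprime k (a * c)
  to k k⊥ (e∣k , e∣ac) = k⊥ (e∣k , ∣-trans e∣ac (*-monoʳ-∣ a (m∣m*n (c ^ b-1))))
  from : ∀ k → Coprime k (a * c) → Coprime k (a * c ^ b)
  from k k⊥ = coprime-*ʳ {a = a}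
    (λ (e∣k , e∣a) → k⊥ (e∣k , ∣m⇒∣m*n c e∣a))
    (coprime-^ʳ b λ (e∣k , e∣c) → k⊥ (e∣k , ∣n⇒∣m*n a e∣c))

-- Sums over coprime pairs and over prime power levels

χ : ℕ → ℕ → ℤ
χ h k = 𝟙 (gcd h k ≟ 1)

-- Exchanging the sums in the h-part counts, for each m, the k ∈ [m,n] prime to m; the
-- diagonal contributes only at m = 1, which D 1 ≡ 0ℤ removes.
∑-coprime-pairs : ∀ n (D : ℕ → ℤ) → D 1 ≡ 0ℤ →
  (∑[1≤ k ≤ n ] ∑[1≤ h ≤ k ] χ h k ℤ.* (D k ℤ.- D h))
    ≡ (∑[1≤ m ≤ n ] D m ℤ.* (+ 2 ℤ.* + φ m ℤ.- cop m n))
∑-coprime-pairs n D D1≡0 = begin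
  (∑[1≤ k ≤ n ] ∑[1≤ h ≤ k ] χ h k ℤ.* (D k ℤ.- D h))
    ≡⟨ ∑-cong n (λ k _ → inner k) ⟩
  (∑[1≤ k ≤ n ] D k ℤ.* + φ k ℤ.- (∑[1≤ h ≤ k ] g h k))
    ≡⟨ ∑-distrib-minus n (λ k → D k ℤ.* + φ k) (λ k → ∑[1≤ h ≤ k ] g h k) ⟩
  Φ ℤ.- A
    -- Adding and subtracting the opposite triangle `B` completes `A` to the square `S`, up to the
    -- vanishing diagonal, while `B` itself equals `Φ`.
    ≡⟨ isolate Φ A B ⟩
  Φ ℤ.+ B ℤ.- (A ℤ.+ B)
    ≡⟨ cong₂ (λ x y → Φ ℤ.+ x ℤ.- y) B≡Φ
         (trans (∑-triangles n g) (trans (cong (λ z → S ℤ.+ z) diagonal) (ℤ.+-identityʳ S))) ⟩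
  Φ ℤ.+ Φ ℤ.- S
    ≡⟨ cong₂ (λ x y → x ℤ.- y) (∑-distrib-+ n (λ m → D m ℤ.* + φ m) (λ m → D m ℤ.* + φ m))
         (∑-cong n (λ m _ → sym (row m n))) ⟨
  (∑[1≤ m ≤ n ] D m ℤ.* + φ m ℤ.+ D m ℤ.* + φ m) ℤ.- (∑[1≤ m ≤ n ] D m ℤ.* cop m n)
    ≡⟨ ∑-distrib-minus n (λ m → D m ℤ.* + φ m ℤ.+ D m ℤ.* + φ m) (λ m → D m ℤ.* cop m n) ⟨
  (∑[1≤ m ≤ n ] (D m ℤ.* + φ m ℤ.+ D m ℤ.* + φ m) ℤ.- D m ℤ.* cop m n)
    ≡⟨ ∑-cong n (λ m _ → collect (D m) (+ φ m) (cop m n)) ⟩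
  (∑[1≤ m ≤ n ] D m ℤ.* (+ 2 ℤ.* + φ m ℤ.- cop m n)) ∎
  where
  g : ℕ → ℕ → ℤ
  g h k = D h ℤ.* χ h k
  Φ A B S : ℤ
  Φ = ∑[1≤ m ≤ n ] D m ℤ.* + φ m
  A = ∑[1≤ k ≤ n ] ∑[1≤ h ≤ k ] g h k
  B = ∑[1≤ h ≤ n ] ∑[1≤ k ≤ h ] g h k
  S = ∑[1≤ h ≤ n ] ∑[1≤ k ≤ n ] g h k

  isolate : ∀ x a b → x ℤ.- a ≡ x ℤ.+ b ℤ.- (a ℤ.+ b)
  isolate = solve-∀
  collect : ∀ x f y → (x ℤ.* f ℤ.+ x ℤ.* f) ℤ.- x ℤ.* y ≡ x ℤ.* (+ 2 ℤ.* f ℤ.- y)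
  collect = solve-∀
  expand : ∀ c x y → c ℤ.* (x ℤ.- y) ≡ x ℤ.* c ℤ.- y ℤ.* c
  expand = solve-∀

  row : ∀ m n → (∑[1≤ k ≤ n ] g m k) ≡ D m ℤ.* cop m n
  row m n = trans (∑-*ˡ n (D m) (λ k → χ m k))
    (cong (λ z → D m ℤ.* z) (∑-cong n λ k _ → cong (λ g → 𝟙 (g ≟ 1)) (gcd-comm m k)))

  B≡Φ : B ≡ Φ
  B≡Φ = ∑-cong n λ m _ → trans (row m m) (cong (λ z → D m ℤ.* z) (sym (φ≡cop m)))

  inner : ∀ k → (∑[1≤ h ≤ k ] χ h k ℤ.* (D k ℤ.- D h)) ≡ D k ℤ.* + φ k ℤ.- (∑[1≤ h ≤ k ] g h k)
  inner k = begin
    (∑[1≤ h ≤ k ] χ h k ℤ.* (D k ℤ.- D h))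
      ≡⟨ ∑-cong k (λ h _ → expand (χ h k) (D k) (D h)) ⟩
    (∑[1≤ h ≤ k ] D k ℤ.* χ h k ℤ.- g h k)
      ≡⟨ ∑-distrib-minus k (λ h → D k ℤ.* χ h k) (λ h → g h k) ⟩
    (∑[1≤ h ≤ k ] D k ℤ.* χ h k) ℤ.- (∑[1≤ h ≤ k ] g h k)
      ≡⟨ cong (ℤ._- (∑[1≤ h ≤ k ] g h k)) (trans (∑-*ˡ k (D k) (λ h → χ h k))
           (cong (λ z → D k ℤ.* z) (sym (φ≡cop k)))) ⟩
    D k ℤ.* + φ k ℤ.- (∑[1≤ h ≤ k ] g h k) ∎

  diagonal : (∑[1≤ i ≤ n ] g i i) ≡ 0ℤ
  diagonal = ∑-zero n λ i _ → vanish i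
    where
    vanish : ∀ i → g i i ≡ 0ℤ
    vanish i with i ≟ 1
    ... | yes refl = trans (ℤ.*-identityʳ (D 1)) D1≡0
    ... | no i≢1   = trans
      (cong (λ z → D i ℤ.* z) (𝟙-false (gcd i i ≟ 1) λ gcd≡1 → i≢1 (gcd≡1⇒coprime gcd≡1 (∣-refl , ∣-refl))))
      (ℤ.*-zeroʳ (D i))

theorem4p1 : (p : ℕ) (p-prime : Prime p) (n : ℕ) → n ≥ 1 →
    let instance p≢0 = prime⇒nonZero p-prime in
    ord p (F̄ n) ≡
      (∑[1≤ b ≤ ⌊log p ⌋ n ] let instance p^b≢0 = m^n≢0 p b in
       ∑[1≤ a ≤ n / p ^ b ] let instance ap^b≢0 = m*n≢0 a (p ^ b)
                                d = n % (a * p ^ b) in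
         + φ (a * p ^ b) ℤ.* (+ 2 ℤ.- + (n / (a * p ^ b)))
           ℤ.- (∑[ j ∣ a * p ] μ j ℤ.* + (d / j)))
theorem4p1 p p-prime n _ = begin
  ord p (F̄ n)
    ≡⟨ ord-F̄ p-prime n ⟩
  (∑[1≤ k ≤ n ] ∑[1≤ h ≤ k ] χ h k ℤ.* (+ exponent p k ℤ.- + exponent p h))
    -- Since `h ≤ k ≤ n`, both exponents are counted over the same levels `b ≤ L`; two exchanges
    -- then bring `b` to the front.
    ≡⟨ ∑-cong n (λ k k≤n → ∑-cong k λ h h≤k → expand k k≤n h (≤-trans h≤k k≤n)) ⟩
  (∑[1≤ k ≤ n ] ∑[1≤ h ≤ k ] ∑[1≤ b ≤ L ] χ h k ℤ.* (D b k ℤ.- D b h))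
    ≡⟨ ∑-cong n (λ k _ → ∑-swap k L (λ h b → χ h k ℤ.* (D b k ℤ.- D b h))) ⟩
  (∑[1≤ k ≤ n ] ∑[1≤ b ≤ L ] ∑[1≤ h ≤ k ] χ h k ℤ.* (D b k ℤ.- D b h))
    ≡⟨ ∑-swap n L (λ k b → ∑[1≤ h ≤ k ] χ h k ℤ.* (D b k ℤ.- D b h)) ⟩
  (∑[1≤ b ≤ L ] ∑[1≤ k ≤ n ] ∑[1≤ h ≤ k ] χ h k ℤ.* (D b k ℤ.- D b h))
    ≡⟨ ∑-cong L (λ b _ → level b) ⟩
  _ ∎
  where
  instance p≢0 = prime⇒nonZero p-prime
  L = ⌊log p ⌋ n
  D : ℕ → ℕ → ℤ
  D b k = 𝟙 (p ^ b ∣? k)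

  expand : ∀ k .{{_ : NonZero k}} → k ≤ n → ∀ h .{{_ : NonZero h}} → h ≤ n →
    χ h k ℤ.* (+ exponent p k ℤ.- + exponent p h) ≡ (∑[1≤ b ≤ L ] χ h k ℤ.* (D b k ℤ.- D b h))
  expand k k≤n h h≤n = begin
    χ h k ℤ.* (+ exponent p k ℤ.- + exponent p h)
      ≡⟨ cong₂ (λ x y → χ h k ℤ.* (x ℤ.- y)) (exponent-∑ p-prime k≤n) (exponent-∑ p-prime h≤n) ⟩
    χ h k ℤ.* ((∑[1≤ b ≤ L ] D b k) ℤ.- (∑[1≤ b ≤ L ] D b h))
      ≡⟨ cong (λ z → χ h k ℤ.* z) (∑-distrib-minus L (λ b → D b k) (λ b → D b h)) ⟨
    χ h k ℤ.* (∑[1≤ b ≤ L ] D b k ℤ.- D b h)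
      ≡⟨ ∑-*ˡ L (χ h k) (λ b → D b k ℤ.- D b h) ⟨
    (∑[1≤ b ≤ L ] χ h k ℤ.* (D b k ℤ.- D b h)) ∎

  -- Division of `n` by `a * p ^ b` contributes the quotient times `φ`, and the remainder becomes
  -- the argument of the Möbius count.
  term : ∀ a b .{{_ : NonZero a}} .{{_ : NonZero b}} .{{_ : NonZero (a * p ^ b)}} →
    + 2 ℤ.* + φ (a * p ^ b) ℤ.- cop (a * p ^ b) n
      ≡ + φ (a * p ^ b) ℤ.* (+ 2 ℤ.- + (n / (a * p ^ b)))
        ℤ.- (∑[ j ∣ a * p ] μ j ℤ.* + (n % (a * p ^ b) / j))
  term a b = begin
    + 2 ℤ.* + φ m ℤ.- cop m n
      ≡⟨ cong (λ z → + 2 ℤ.* + φ m ℤ.- z) (cop-divMod m n) ⟩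
    + 2 ℤ.* + φ m ℤ.- (+ (n / m) ℤ.* + φ m ℤ.+ cop m (n % m))
      ≡⟨ collect (+ φ m) (+ (n / m)) (cop m (n % m)) ⟩
    + φ m ℤ.* (+ 2 ℤ.- + (n / m)) ℤ.- cop m (n % m)
      ≡⟨ cong (λ z → + φ m ℤ.* (+ 2 ℤ.- + (n / m)) ℤ.- z)
           (trans (cop-radical a p b (n % m)) (cop-μ (a * p) (n % m) {{m*n≢0 a p}})) ⟩
    + φ m ℤ.* (+ 2 ℤ.- + (n / m)) ℤ.- (∑[ j ∣ a * p ] μ j ℤ.* + (n % m / j)) ∎
    where
    m = a * p ^ b
    collect : ∀ f q y → + 2 ℤ.* f ℤ.- (q ℤ.* f ℤ.+ y) ≡ f ℤ.* (+ 2 ℤ.- q) ℤ.- y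
    collect = solve-∀

  -- Levels start at 1, so `p ^ b` exceeds 1 and cannot divide it.
  D1≡0 : ∀ b .{{_ : NonZero b}} → D b 1 ≡ 0ℤ
  D1≡0 b = 𝟙-false (p ^ b ∣? 1) (>⇒∤ (≤-<-trans (>-nonZero⁻¹ b) (n<m^n (1<p p-prime) b)))

  level : ∀ b .{{_ : NonZero b}} → let instance p^b≢0 = m^n≢0 p b in
    (∑[1≤ k ≤ n ] ∑[1≤ h ≤ k ] χ h k ℤ.* (D b k ℤ.- D b h))
      ≡ (∑[1≤ a ≤ n / p ^ b ] let instance ap^b≢0 = m*n≢0 a (p ^ b)
                                  d = n % (a * p ^ b) in
         + φ (a * p ^ b) ℤ.* (+ 2 ℤ.- + (n / (a * p ^ b)))
           ℤ.- (∑[ j ∣ a * p ] μ j ℤ.* + (d / j)))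
  level b = begin
    (∑[1≤ k ≤ n ] ∑[1≤ h ≤ k ] χ h k ℤ.* (D b k ℤ.- D b h))
      ≡⟨ ∑-coprime-pairs n (D b) (D1≡0 b) ⟩
    (∑[1≤ m ≤ n ] D b m ℤ.* (+ 2 ℤ.* + φ m ℤ.- cop m n))
      -- `D b m` is the indicator of `p ^ b ∣ m`, so only `m = a * p ^ b` with `a ≤ n / p ^ b`
      -- remain.
      ≡⟨ ∑-multiples n (p ^ b) (λ m → + 2 ℤ.* + φ m ℤ.- cop m n) ⟩
    (∑[1≤ a ≤ n / p ^ b ] + 2 ℤ.* + φ (a * p ^ b) ℤ.- cop (a * p ^ b) n)
      ≡⟨ ∑-cong (n / p ^ b) (λ a _ → term a b {{it}} {{it}} {{m*n≢0 a (p ^ b)}}) ⟩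
    _ ∎
    where instance p^b≢0 = m^n≢0 p b
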